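{- Let $T$ be a trunk of an order $P$. Any two chains $C,C'\subseteq T$ that are maximal among the chains contained in $T$ are order-isomorphic (in particular they have the same cardinality). Moreover, if $T$ is a full trunk of $P$, then every element of $T$ belongs to a chain contained in $T$ that is order-isomorphic to a maximum chain of $P$.
   Context: Orders are partial orders; $x\sim y$ means $x\ne y$ and $x,y$ incomparable. A trunk of $P$ is a subset $T$ (with the induced order) such that for all pairwise distinct $x,y,z\in T$, $x\sim y$ and $y\sim z$ imply $x\sim z$. A chain of $P$ is maximum if it is maximal under inclusion and no chain of $P$ has greater cardinality (for a well-founded order: greater order type). A full trunk is a trunk containing at least one maximum chain of $P$. -}

module Defs where

open import Level using (Level; _⊔_; suc)
open import Data.Product using (Σ; ∃; _×_; _,_; proj₁)
open import Data.Sum using (_⊎_)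
open import Data.Unit.Polymorphic using (⊤)
open import Function.Bundles using (Injection; Bijection)
open import Induction.WellFounded using (WellFounded)
open import Relation.Binary.Bundles using (Setoid; Poset)
open import Relation.Binary.Morphism.Structures using (IsOrderIsomorphism)
open import Relation.Nullary using (¬_)
open import Relation.Unary using (Pred)
import Relation.Binary.Construct.On as On
import Relation.Binary.Definitions as B
import Relation.Binary.Properties.Poset as PosetProperties

module Trunks {c ℓ₁ ℓ₂ : Level} (P : Poset c ℓ₁ ℓ₂) where

  open Poset P using (Carrier; _≈_; _≤_)
  open PosetProperties P using (_<_; <-respˡ-≈)

  -- Equality in a stdlib poset is a setoid equality, so a subset is a
  -- predicate that respects it.
  record Subset (p : Level) : Set (c ⊔ ℓ₁ ⊔ suc p) where
    field
      Member  : Pred Carrier p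
      respect : Member B.Respects _≈_

  open Subset public

  infix 4 _∈_ _⊆_ _∼_ _≅_ _<ᶜ_ _<ᵒ_ _≈ᶜ_

  _∈_ : ∀ {p} → Carrier → Subset p → Set p
  x ∈ S = Member S x

  _⊆_ : ∀ {p q} → Subset p → Subset q → Set (c ⊔ p ⊔ q)
  S ⊆ S′ = ∀ {x} → x ∈ S → x ∈ S′

  whole : ∀ {p} → Subset p
  whole = record { Member = λ _ → ⊤ ; respect = λ _ t → t }

  -- Elements of the induced order are compared through their first
  -- component only, so membership proofs play no role.
  induced : ∀ {p} → Subset p → Poset (c ⊔ p) ℓ₁ ℓ₂
  induced S = On.poset P (proj₁ {B = Member S})

  inducedSetoid : ∀ {p} → Subset p → Setoid (c ⊔ p) ℓ₁
  inducedSetoid S = Poset.Eq.setoid (induced S)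

  _≅_ : ∀ {p q} → Subset p → Subset q → Set (c ⊔ ℓ₁ ⊔ ℓ₂ ⊔ p ⊔ q)
  S ≅ S′ = ∃ λ f → IsOrderIsomorphism I._≈_ I′._≈_ I._≤_ I′._≤_ f
    where
    module I  = Poset (induced S)
    module I′ = Poset (induced S′)

  _≈ᶜ_ : ∀ {p q} → Subset p → Subset q → Set (c ⊔ ℓ₁ ⊔ p ⊔ q)
  S ≈ᶜ S′ = Bijection (inducedSetoid S) (inducedSetoid S′)

  -- Strict inequality of cardinals: |S| ≤ |S′| and not |S′| ≤ |S|.
  _<ᶜ_ : ∀ {p q} → Subset p → Subset q → Set (c ⊔ ℓ₁ ⊔ p ⊔ q)
  S <ᶜ S′ = Injection (inducedSetoid S) (inducedSetoid S′)
          × ¬ Injection (inducedSetoid S′) (inducedSetoid S)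

  below : ∀ {p} → Subset p → Carrier → Subset (ℓ₁ ⊔ ℓ₂ ⊔ p)
  below S d = record
    { Member  = λ x → x ∈ S × x < d
    ; respect = λ x≈y (x∈S , x<d) → respect S x≈y x∈S , <-respˡ-≈ x≈y x<d
    }

  -- Strict inequality of order types of well-ordered subsets (ordinals):
  -- S is isomorphic to a proper initial segment of S′.
  _<ᵒ_ : ∀ {p q} → Subset p → Subset q → Set (c ⊔ ℓ₁ ⊔ ℓ₂ ⊔ p ⊔ q)
  S <ᵒ S′ = ∃ λ d → d ∈ S′ × S ≅ below S′ d

  Comparable : Carrier → Carrier → Set ℓ₂
  Comparable x y = x ≤ y ⊎ y ≤ x

  _∼_ : Carrier → Carrier → Set (ℓ₁ ⊔ ℓ₂)
  x ∼ y = ¬ (x ≈ y) × ¬ Comparable x y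

  IsTrunk : ∀ {p} → Subset p → Set (c ⊔ ℓ₁ ⊔ ℓ₂ ⊔ p)
  IsTrunk T = ∀ {x y z} → x ∈ T → y ∈ T → z ∈ T →
              ¬ (x ≈ y) → ¬ (y ≈ z) → ¬ (x ≈ z) →
              x ∼ y → y ∼ z → x ∼ z

  IsChain : ∀ {p} → Subset p → Set (c ⊔ ℓ₂ ⊔ p)
  IsChain C = ∀ {x y} → x ∈ C → y ∈ C → Comparable x y

  IsMaximalChainIn : ∀ {p} → Subset p → Subset p → Set (c ⊔ ℓ₁ ⊔ ℓ₂ ⊔ suc p)
  IsMaximalChainIn {p} T C =
    IsChain C × C ⊆ T ×
    ((D : Subset p) → IsChain D → D ⊆ T → C ⊆ D → D ⊆ C)

  -- Chains are compared by order type if P is well-founded, and by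
  -- cardinality otherwise.
  IsMaximumChain : ∀ {p} → Subset p → Set (c ⊔ ℓ₁ ⊔ ℓ₂ ⊔ suc p)
  IsMaximumChain {p} C =
    IsMaximalChainIn whole C ×
    (WellFounded _<_ → (D : Subset p) → IsChain D → ¬ (C <ᵒ D)) ×
    (¬ WellFounded _<_ → (D : Subset p) → IsChain D → ¬ (C <ᶜ D))

  IsFullTrunk : ∀ {p} → Subset p → Set (c ⊔ ℓ₁ ⊔ ℓ₂ ⊔ suc p)
  IsFullTrunk {p} T = IsTrunk T × Σ (Subset p) λ M → IsMaximumChain M × M ⊆ T

{-# OPTIONS --safe #-}
-- On a trunk T the relation "equal or incomparable" is an equivalence, and the
-- order only depends on the classes: T is a linear sum of antichains.  A chain
-- that is maximal in T meets every class in exactly one point, so matching the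
-- points of C and C′ class by class is an order isomorphism.  For the second
-- part, replace the point of a maximum chain M lying in the class of x by x;
-- the result is again a maximal chain of T, hence isomorphic to M.
module Submission where

open import Defs
open import Level using (Level; _⊔_; Lift; lift; lower)
open import Axiom.ExcludedMiddle using (ExcludedMiddle)
open import Data.Product using (Σ; ∃; _×_; _,_; proj₁; proj₂)
open import Data.Sum using (_⊎_; inj₁; inj₂; swap)
open import Function.Base using (_∘_)
open import Relation.Binary.Bundles using (Poset)
open import Relation.Binary.Morphism.Structures using (IsOrderIsomorphism)
open import Relation.Nullary using (¬_; yes; no; contradiction)
open import Relation.Nullary.Decidable using (True; toWitness; fromWitness; map′)

lower-em : ∀ {a} b → ExcludedMiddle (a ⊔ b) → ExcludedMiddle a
lower-em b em {A} = map′ lower lift (em {Lift b A})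

module _ {c ℓ₁ ℓ₂ : Level} (P : Poset c ℓ₁ ℓ₂) where

  open Trunks P
  open Poset P using (Carrier; _≈_; _≤_; module Eq; reflexive; antisym)
    renaming (trans to ≤-trans)

  ≅⇒≈ᶜ : ∀ {p q} {S : Subset p} {S′ : Subset q} → S ≅ S′ → S ≈ᶜ S′
  ≅⇒≈ᶜ (f , iso) = record
    { to        = f
    ; cong      = IsOrderIsomorphism.cong iso
    ; bijective = IsOrderIsomorphism.injective iso , IsOrderIsomorphism.surjective iso
    }

  -- Maximality only quantifies over subsets of level p, whereas the competing
  -- chains below also mention ≈ and ≤; excluded middle makes every subset small.
  module _ {q : Level} (p : Level) (em : ExcludedMiddle q) (S : Subset q) where

    resize : Subset p
    resize = record
      { Member  = λ x → Lift p (True (em {x ∈ S}))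
      ; respect = λ x≈y (lift t) → lift (fromWitness (respect S x≈y (toWitness t)))
      }

    ∈-resize⁺ : S ⊆ resize
    ∈-resize⁺ x∈S = lift (fromWitness x∈S)

    ∈-resize⁻ : resize ⊆ S
    ∈-resize⁻ (lift t) = toWitness t

  infix 4 _⋈_

  -- Classically this is `x ≈ y` or `x ∼ y`. As an implication it can be applied directly: two
  -- members of one chain in the same class are equal.
  _⋈_ : Carrier → Carrier → Set (ℓ₁ ⊔ ℓ₂)
  x ⋈ y = Comparable x y → x ≈ y

  ≈⇒⋈ : ∀ {x y} → x ≈ y → x ⋈ y
  ≈⇒⋈ x≈y _ = x≈y

  ⋈-sym : ∀ {x y} → x ⋈ y → y ⋈ x
  ⋈-sym x⋈y = Eq.sym ∘ x⋈y ∘ swap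

  Comparable-respʳ : ∀ {x y z} → y ≈ z → Comparable x y → Comparable x z
  Comparable-respʳ y≈z (inj₁ x≤y) = inj₁ (≤-trans x≤y (reflexive y≈z))
  Comparable-respʳ y≈z (inj₂ y≤x) = inj₂ (≤-trans (reflexive (Eq.sym y≈z)) y≤x)

  ⋈-respʳ : ∀ {x y z} → y ≈ z → x ⋈ y → x ⋈ z
  ⋈-respʳ y≈z x⋈y x≶z = Eq.trans (x⋈y (Comparable-respʳ (Eq.sym y≈z) x≶z)) y≈z

  ⋈-respˡ : ∀ {x y z} → x ≈ y → x ⋈ z → y ⋈ z
  ⋈-respˡ x≈y = ⋈-sym ∘ ⋈-respʳ x≈y ∘ ⋈-sym

  module _ {p : Level} (em : ExcludedMiddle (c ⊔ ℓ₁ ⊔ ℓ₂ ⊔ p)) where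

    private
      em-≈ : ExcludedMiddle ℓ₁
      em-≈ = lower-em (c ⊔ ℓ₂ ⊔ p) em

      em-≤ : ExcludedMiddle ℓ₂
      em-≤ = lower-em (c ⊔ ℓ₁ ⊔ p) em

      em-⋈ : ExcludedMiddle (ℓ₁ ⊔ ℓ₂)
      em-⋈ = lower-em (c ⊔ p) em

    ¬⋈⇒Comparable : ∀ {x y} → ¬ (x ⋈ y) → Comparable x y
    ¬⋈⇒Comparable ¬x⋈y with em-≤
    ... | yes x≶y = x≶y
    ... | no ¬x≶y = contradiction (λ x≶y → contradiction x≶y ¬x≶y) ¬x⋈y

    module _ {T : Subset p} (trunk : IsTrunk T) where

      -- The trunk condition speaks only of pairwise distinct points, where it rules out
      -- `Comparable x z`; coincidences among the three points are settled first.
      ⋈-trans : ∀ {x y z} → x ∈ T → y ∈ T → z ∈ T → x ⋈ y → y ⋈ z → x ⋈ z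
      ⋈-trans {x} {y} {z} x∈T y∈T z∈T x⋈y y⋈z x≶z
        with em-≈ {x ≈ y} | em-≈ {y ≈ z} | em-≈ {x ≈ z}
      ... | yes x≈y | _       | _       = ⋈-respˡ (Eq.sym x≈y) y⋈z x≶z
      ... | no _    | yes y≈z | _       = ⋈-respʳ y≈z x⋈y x≶z
      ... | no _    | no _    | yes x≈z = x≈z
      ... | no x≉y  | no y≉z  | no x≉z  = contradiction x≶z (proj₂
        (trunk x∈T y∈T z∈T x≉y y≉z x≉z (x≉y , x≉y ∘ x⋈y) (y≉z , y≉z ∘ y⋈z)))

      -- The critical case is `y′ ≤ x′`, settled by comparing `x` with `y′`. If `x ≤ y′`, then
      -- `x ≤ x′`, so `x ≈ x′`. If `y′ ≤ x`, then `y′ ≤ y`, so `y ≈ y′` and hence `x ≈ y′`. This and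
      -- incomparability both give `x ⋈ y′`, so the comparable points `x′` and `y′` share a class
      -- and are equal.
      ⋈-mono : ∀ {x y x′ y′} → x ∈ T → y ∈ T → x′ ∈ T → y′ ∈ T →
               x ⋈ x′ → y ⋈ y′ → Comparable x′ y′ → x ≤ y → x′ ≤ y′
      ⋈-mono {x} {y} {x′} {y′} x∈T y∈T x′∈T y′∈T x⋈x′ y⋈y′ x′≶y′ x≤y
        with x′≶y′ | em-≤ {Comparable x y′}
      ... | inj₁ x′≤y′ | _ = x′≤y′
      ... | inj₂ y′≤x′ | yes (inj₁ x≤y′) =
        ≤-trans (reflexive (Eq.sym (x⋈x′ (inj₁ (≤-trans x≤y′ y′≤x′))))) x≤y′
      ... | inj₂ y′≤x′ | yes (inj₂ y′≤x) = reflexive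
        (⋈-trans x′∈T x∈T y′∈T (⋈-sym x⋈x′) (≈⇒⋈ x≈y′) x′≶y′)
        where
        y≈y′ : y ≈ y′
        y≈y′ = y⋈y′ (inj₂ (≤-trans y′≤x x≤y))
        x≈y′ : x ≈ y′
        x≈y′ = antisym (≤-trans x≤y (reflexive y≈y′)) y′≤x
      ... | inj₂ y′≤x′ | no ¬x≶y′ = reflexive
        (⋈-trans x′∈T x∈T y′∈T (⋈-sym x⋈x′) (λ x≶y′ → contradiction x≶y′ ¬x≶y′) x′≶y′)

      -- If no point of `C` lay in the class of `x`, then `x` would be comparable to all of `C`.
      -- Adding `x` would keep a chain in `T`, so maximality puts `x` itself in `C`.
      class-representative : ∀ {C : Subset p} → IsMaximalChainIn T C →
        ∀ {x} → x ∈ T → ∃ λ y → y ∈ C × x ⋈ y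
      class-representative {C} (chain , C⊆T , maximal) {x} x∈T with em {∃ λ y → y ∈ C × x ⋈ y}
      ... | yes representative = representative
      ... | no none = x , maximal (resize p em-p C∪x) C∪x-chain C∪x⊆T
                            (λ y∈C → ∈-resize⁺ p em-p C∪x (inj₁ y∈C))
                            (∈-resize⁺ p em-p C∪x (inj₂ Eq.refl))
                        , ≈⇒⋈ Eq.refl
        where
        em-p : ExcludedMiddle (ℓ₁ ⊔ p)
        em-p = lower-em (c ⊔ ℓ₂) em

        C∪x : Subset (ℓ₁ ⊔ p)
        C∪x = record
          { Member  = λ y → y ∈ C ⊎ y ≈ x
          ; respect = λ { y≈z (inj₁ y∈C) → inj₁ (respect C y≈z y∈C)
                        ; y≈z (inj₂ y≈x) → inj₂ (Eq.trans (Eq.sym y≈z) y≈x) }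
          }

        x≶C : ∀ {y} → y ∈ C → Comparable x y
        x≶C y∈C = ¬⋈⇒Comparable λ x⋈y → none (_ , y∈C , x⋈y)

        comparable : IsChain C∪x
        comparable (inj₁ y∈C) (inj₁ z∈C) = chain y∈C z∈C
        comparable (inj₁ y∈C) (inj₂ z≈x) = Comparable-respʳ (Eq.sym z≈x) (swap (x≶C y∈C))
        comparable (inj₂ y≈x) (inj₁ z∈C) = swap (Comparable-respʳ (Eq.sym y≈x) (swap (x≶C z∈C)))
        comparable (inj₂ y≈x) (inj₂ z≈x) = inj₁ (reflexive (Eq.trans y≈x (Eq.sym z≈x)))

        C∪x-chain : IsChain (resize p em-p C∪x)
        C∪x-chain y∈ z∈ = comparable (∈-resize⁻ p em-p C∪x y∈) (∈-resize⁻ p em-p C∪x z∈)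

        C∪x⊆T : resize p em-p C∪x ⊆ T
        C∪x⊆T y∈ with ∈-resize⁻ p em-p C∪x y∈
        ... | inj₁ y∈C = C⊆T y∈C
        ... | inj₂ y≈x = respect T (Eq.sym y≈x) x∈T

      maximalChains-≅ : ∀ {C C′ : Subset p} →
        IsMaximalChainIn T C → IsMaximalChainIn T C′ → C ≅ C′
      maximalChains-≅ {C} {C′} C-max@(C-chain , C⊆T , _) C′-max@(C′-chain , C′⊆T , _) =
        f , record
          { isOrderMonomorphism = record
            { isOrderHomomorphism = record
              -- The choice of representatives need not visibly respect `≈`; congruence comes from
              -- monotonicity in both directions, and injectivity likewise from `cancel`.
              { cong = λ {a} {b} a≈b → antisym (mono {a} {b} (reflexive a≈b))
                                               (mono {b} {a} (reflexive (Eq.sym a≈b)))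
              ; mono = λ {a} {b} → mono {a} {b}
              }
            ; injective = λ {a} {b} fa≈fb → antisym (cancel {a} {b} (reflexive fa≈fb))
                                                    (cancel {b} {a} (reflexive (Eq.sym fa≈fb)))
            ; cancel = λ {a} {b} → cancel {a} {b}
            }
          ; surjective = surjective
          }
        where
        f : ∃ (Member C) → ∃ (Member C′)
        f (x , x∈C) with class-representative {C′} C′-max (C⊆T x∈C)
        ... | y , y∈C′ , _ = y , y∈C′

        ⋈-f : ∀ a → proj₁ a ⋈ proj₁ (f a)
        ⋈-f (x , x∈C) = proj₂ (proj₂ (class-representative {C′} C′-max (C⊆T x∈C)))

        dom∈T : ∀ (a : ∃ (Member C)) → proj₁ a ∈ T
        dom∈T (_ , x∈C) = C⊆T x∈C

        cod∈T : ∀ (b : ∃ (Member C′)) → proj₁ b ∈ T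
        cod∈T (_ , y∈C′) = C′⊆T y∈C′

        mono : ∀ {a b} → proj₁ a ≤ proj₁ b → proj₁ (f a) ≤ proj₁ (f b)
        mono {a} {b} = ⋈-mono (dom∈T a) (dom∈T b) (cod∈T (f a)) (cod∈T (f b))
          (⋈-f a) (⋈-f b) (C′-chain (proj₂ (f a)) (proj₂ (f b)))

        -- Being in the same class is symmetric, so `⋈-mono` also transports the order back from
        -- `C′` to `C`.
        cancel : ∀ {a b} → proj₁ (f a) ≤ proj₁ (f b) → proj₁ a ≤ proj₁ b
        cancel {a} {b} = ⋈-mono (cod∈T (f a)) (cod∈T (f b)) (dom∈T a) (dom∈T b)
          (⋈-sym (⋈-f a)) (⋈-sym (⋈-f b)) (C-chain (proj₂ a) (proj₂ b))

        surjective : ∀ b → ∃ λ a → ∀ {z} → proj₁ z ≈ proj₁ a → proj₁ (f z) ≈ proj₁ b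
        surjective b@(y , y∈C′) with class-representative {C} C-max (C′⊆T y∈C′)
        -- The preimage is the representative of `y` in `C`: both `f z` and `y` lie in the class of
        -- `z`, and two points of the chain `C′` in one class are equal.
        ... | x , x∈C , y⋈x = (x , x∈C) , λ {z} z≈x →
          ⋈-trans (cod∈T (f z)) (dom∈T z) (cod∈T b)
            (⋈-sym (⋈-f z)) (⋈-respˡ (Eq.sym z≈x) (⋈-sym y⋈x))
            (C′-chain (proj₂ (f z)) y∈C′)

      maximalChain-through : ∀ {M : Subset p} → IsMaximalChainIn T M →
        ∀ {x} → x ∈ T → Σ (Subset p) λ D → IsMaximalChainIn T D × x ∈ D
      maximalChain-through {M} M-max@(M-chain , M⊆T , _) {x} x∈T =
        D , (D-chain , D⊆T , D-maximal) , ∈-resize⁺ p em-p S (inj₁ Eq.refl)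
        where
        em-p : ExcludedMiddle (ℓ₁ ⊔ ℓ₂ ⊔ p)
        em-p = lower-em c em

        -- M with its representative of the class of x replaced by x.
        S : Subset (ℓ₁ ⊔ ℓ₂ ⊔ p)
        S = record
          { Member  = λ y → y ≈ x ⊎ (y ∈ M × ¬ (x ⋈ y))
          ; respect = λ { y≈z (inj₁ y≈x) → inj₁ (Eq.trans (Eq.sym y≈z) y≈x)
                        ; y≈z (inj₂ (y∈M , ¬x⋈y)) → inj₂ (respect M y≈z y∈M ,
                            ¬x⋈y ∘ ⋈-respʳ (Eq.sym y≈z)) }
          }

        D : Subset p
        D = resize p em-p S

        comparable : IsChain S
        comparable (inj₁ y≈x) (inj₁ z≈x) = inj₁ (reflexive (Eq.trans y≈x (Eq.sym z≈x)))
        comparable (inj₁ y≈x) (inj₂ (_ , ¬x⋈z)) =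
          swap (Comparable-respʳ (Eq.sym y≈x) (swap (¬⋈⇒Comparable ¬x⋈z)))
        comparable (inj₂ (_ , ¬x⋈y)) (inj₁ z≈x) =
          Comparable-respʳ (Eq.sym z≈x) (swap (¬⋈⇒Comparable ¬x⋈y))
        comparable (inj₂ (y∈M , _)) (inj₂ (z∈M , _)) = M-chain y∈M z∈M

        D-chain : IsChain D
        D-chain y∈D z∈D = comparable (∈-resize⁻ p em-p S y∈D) (∈-resize⁻ p em-p S z∈D)

        D⊆T : D ⊆ T
        D⊆T y∈D with ∈-resize⁻ p em-p S y∈D
        ... | inj₁ y≈x       = respect T (Eq.sym y≈x) x∈T
        ... | inj₂ (y∈M , _) = M⊆T y∈M

        D-maximal : (E : Subset p) → IsChain E → E ⊆ T → D ⊆ E → E ⊆ D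
        D-maximal E E-chain E⊆T D⊆E {e} e∈E with class-representative {M} M-max (E⊆T e∈E)
        -- If `m` is in the class of `x`, so is `e`, and `e ≈ x` because `E` is a chain containing
        -- both. Otherwise `m` survives in `D`, so `E` contains both `e` and `m`, which forces
        -- `e ≈ m`.
        ... | m , m∈M , e⋈m with em-⋈ {x ⋈ m}
        ... | yes x⋈m = ∈-resize⁺ p em-p S (inj₁
          (⋈-trans (E⊆T e∈E) (M⊆T m∈M) x∈T e⋈m (⋈-sym x⋈m)
            (E-chain e∈E (D⊆E (∈-resize⁺ p em-p S (inj₁ Eq.refl))))))
        ... | no ¬x⋈m = respect D (Eq.sym (e⋈m (E-chain e∈E (D⊆E m∈D)))) m∈D
          where
          m∈D : m ∈ D
          m∈D = ∈-resize⁺ p em-p S (inj₂ (m∈M , ¬x⋈m))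

theorem5p4 : ∀ {c ℓ₁ ℓ₂ p : Level} → ExcludedMiddle (c ⊔ ℓ₁ ⊔ ℓ₂ ⊔ p) →
    (P : Poset c ℓ₁ ℓ₂) → let open Trunks P in
    (T : Subset p) → IsTrunk T →
    ((C C′ : Subset p) → IsMaximalChainIn T C → IsMaximalChainIn T C′ →
    (C ≅ C′) × (C ≈ᶜ C′))
    ×
    (IsFullTrunk T → ∀ x → x ∈ T →
    Σ (Subset p) λ D → IsChain D × D ⊆ T × x ∈ D ×
    Σ (Subset p) λ M → IsMaximumChain M × D ≅ M)
theorem5p4 {p = p} em P T trunk = part₁ , part₂
  where
  open Trunks P

  part₁ : (C C′ : Subset p) → IsMaximalChainIn T C → IsMaximalChainIn T C′ →
          (C ≅ C′) × (C ≈ᶜ C′)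
  part₁ C C′ C-max C′-max = C≅C′ , ≅⇒≈ᶜ P {S = C} {S′ = C′} C≅C′
    where
    C≅C′ : C ≅ C′
    C≅C′ = maximalChains-≅ P em {T} trunk {C} {C′} C-max C′-max

  part₂ : IsFullTrunk T → ∀ x → x ∈ T →
          Σ (Subset p) λ D → IsChain D × D ⊆ T × x ∈ D ×
          Σ (Subset p) λ M → IsMaximumChain M × D ≅ M
  part₂ (_ , M , M-maximum@((M-chain , _ , M-maximal) , _) , M⊆T) x x∈T =
    let M-max : IsMaximalChainIn T M
        -- Chains of `T` are chains of `P`, so maximality in `P` restricts to `T`; the last
        -- underscore is the trivial inclusion in `whole`.
        M-max = M-chain , M⊆T , λ E E-chain _ → M-maximal E E-chain _
        D , D-max@(D-chain , D⊆T , _) , x∈D =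
          maximalChain-through P em {T} trunk {M} M-max x∈T
    in D , D-chain , D⊆T , x∈D , M , M-maximum ,
       maximalChains-≅ P em {T} trunk {D} {M} D-max M-max
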